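{- Let $\mathbf C$ be a full subcategory of $\mathbf{OMet}_{ners}$ such that for every positive integer $m$ and every $\delta\in\mathrm{Spec}(\mathbf C)$ there is an integer $n\ge m$ such that $\mathcal M_{n,\delta}\in\mathrm{Ob}(\mathbf C)$. Then $\mathbf C$ has the dual Ramsey property. In particular, the following categories have the dual Ramsey property: (1) the category $\mathbf{OMet}_{ners}$; (2) for each $S\subseteq\mathbb R$, the full subcategory $\mathbf{OMet}_{ners}(S)$ of $\mathbf{OMet}_{ners}$ spanned by all finite linearly ordered metric spaces $\mathcal M$ with $\mathrm{Spec}(\mathcal M)\subseteq S$.
   Context: A linearly ordered metric space is $\mathcal M=(M,d,\sqsubset)$ with $d$ a metric on $M$ and $\sqsubset$ a (strict) linear order on $M$. A surjection $f$ between finite chains $(X,\sqsubset)\to(Y,\sqsubset')$ is rigid if $\min f^{ -1}(x)\sqsubset\min f^{ -1}(y)$ whenever $x\sqsubset'y$. A non-expansive rigid surjection from $(M,d,\sqsubset)$ to $(M',d',\sqsubset')$ is a map $f:M\to M'$ with $d'(f(x),f(y))\le d(x,y)$ for all $x,y\in M$ and such that $f:(M,\sqsubset)\to(M',\sqsubset')$ is a rigid surjection. $\mathbf{OMet}_{ners}$ is the category of finite linearly ordered metric spaces and non-expansive rigid surjections. $\mathrm{Spec}(\mathcal M)=\{d(x,y):x,y\in M,\ x\ne y\}$, and $\mathrm{Spec}(\mathbf C)=\bigcup\{\mathrm{Spec}(\mathcal M):\mathcal M\in\mathrm{Ob}(\mathbf C)\}$. For a positive integer $n$ and a real $\delta>0$,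 $\mathcal M_{n,\delta}=(\{1,\ldots,n\},d_n^\delta,<)$ where $<$ is the usual order and $d_n^\delta(x,y)=\delta$ whenever $x\neq y$. A category $\mathbf C$ has the dual Ramsey property if for every integer $k\ge2$ and all objects $\mathcal A,\mathcal B$ with $\hom_{\mathbf C}(\mathcal B,\mathcal A)\neq\varnothing$ there is an object $\mathcal C$ such that for every coloring $\chi:\hom_{\mathbf C}(\mathcal C,\mathcal A)\to\{1,\ldots,k\}$ there is $w\in\hom_{\mathbf C}(\mathcal C,\mathcal B)$ such that $\chi$ is constant on $\{f\cdot w: f\in\hom_{\mathbf C}(\mathcal B,\mathcal A)\}$. -}

module Defs where

open import Level using (Level; _⊔_; 0ℓ) renaming (suc to lsuc)
open import Data.Nat.Base as ℕ using (ℕ; zero; suc)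
open import Data.Fin.Base as Fin using (Fin; zero; suc)
import Data.Fin.Properties as Fin
open import Data.Rational.Base as ℚ using (ℚ; 0ℚ; 1ℚ)
import Data.Rational.Properties as ℚ
open import Data.Product.Base using (Σ-syntax; ∃-syntax; _×_; _,_; proj₁; proj₂)
open import Data.Sum.Base using (_⊎_; inj₁; inj₂)
open import Function.Base using (id; _∘_)
open import Function.Bundles using (_↔_; Inverse; Func)
open import Function.Construct.Identity using (↔-id)
open import Function.Definitions using (Surjective)
import Function.Construct.Identity as Identity
import Function.Construct.Composition as Composition
open import Function.Metric.Structures using (IsGeneralMetric)
open import Relation.Binary.Bundles using (Setoid)
open import Relation.Binary.Core using (Rel)
open import Relation.Binary.Definitions using (tri<; tri≈; tri>)
open import Relation.Binary.Structures
  using (IsEquivalence; IsPartialOrder; IsStrictTotalOrder)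
import Relation.Binary.Construct.NonStrictToStrict as NonStrictToStrict
import Relation.Binary.Construct.StrictToNonStrict as StrictToNonStrict
open import Relation.Binary.PropositionalEquality
open import Relation.Nullary using (¬_; yes; no; contradiction)
open import Relation.Unary using (Pred; _∈_; _∉_; _⊆_; Decidable)

------------------------------------------------------------------------
-- Real numbers

-- Dedekind cuts in the textbook one-sided form: proper nonempty initial
-- segments of ℚ with no greatest element. This is the usual real line
-- only under excluded middle (without it these are the bounded lower
-- reals), so results about ℝ should assume it.
record ℝ : Set₁ where
  field
    lower     : Pred ℚ 0ℓ
    inhabited : ∃[ q ] q ∈ lower
    proper    : ∃[ q ] q ∉ lower
    closed    : ∀ {p q} → p ℚ.< q → q ∈ lower → p ∈ lower
    open′     : ∀ {q} → q ∈ lower → ∃[ r ] q ℚ.< r × r ∈ lower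

open ℝ

infix  4 _≤_ _≃_
infixl 6 _+_

_≤_ : Rel ℝ 0ℓ
x ≤ y = ∀ q → q ∈ lower x → q ∈ lower y

_≃_ : Rel ℝ 0ℓ
x ≃ y = x ≤ y × y ≤ x

-- x < y  means  x ≤ y × ¬ x ≃ y.
open NonStrictToStrict _≃_ _≤_ public using (_<_)

0ℝ : ℝ
0ℝ = record
  { lower     = ℚ._< 0ℚ
  ; inhabited = ℚ.- 1ℚ , ℚ.negative⁻¹ (ℚ.- 1ℚ)
  ; proper    = 0ℚ , ℚ.<-irrefl refl
  ; closed    = ℚ.<-trans
  ; open′     = ℚ.<-dense
  }

lower<proper : ∀ x {p q} → p ∈ lower x → q ∉ lower x → p ℚ.< q
lower<proper x {p} {q} p∈x q∉x with ℚ.<-cmp p q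
... | tri< p<q _ _ = p<q
... | tri≈ _ refl _ = contradiction p∈x q∉x
... | tri> _ _ q<p = contradiction (closed x q<p p∈x) q∉x

[r-q]+q≡r : ∀ r q → (r ℚ.- q) ℚ.+ q ≡ r
[r-q]+q≡r r q = begin
  (r ℚ.- q) ℚ.+ q      ≡⟨ ℚ.+-assoc r (ℚ.- q) q ⟩
  r ℚ.+ (ℚ.- q ℚ.+ q)  ≡⟨ cong (r ℚ.+_) (ℚ.+-inverseˡ q) ⟩
  r ℚ.+ 0ℚ             ≡⟨ ℚ.+-identityʳ r ⟩
  r                    ∎
  where open ≡-Reasoning

[p+q]-q≡p : ∀ p q → (p ℚ.+ q) ℚ.- q ≡ p
[p+q]-q≡p p q = begin
  (p ℚ.+ q) ℚ.- q      ≡⟨ ℚ.+-assoc p q (ℚ.- q) ⟩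
  p ℚ.+ (q ℚ.- q)      ≡⟨ cong (p ℚ.+_) (ℚ.+-inverseʳ q) ⟩
  p ℚ.+ 0ℚ             ≡⟨ ℚ.+-identityʳ p ⟩
  p                    ∎
  where open ≡-Reasoning

-- The sumset {p + q : p ∈ P, q ∈ Q}.
_⊕_ : Pred ℚ 0ℓ → Pred ℚ 0ℓ → Pred ℚ 0ℓ
(P ⊕ Q) r = ∃[ p ] ∃[ q ] p ∈ P × q ∈ Q × r ≡ p ℚ.+ q

_+_ : ℝ → ℝ → ℝ
x + y = record
  { lower     = lower x ⊕ lower y
  ; inhabited =
      let p , p∈x = inhabited x
          q , q∈y = inhabited y
      in p ℚ.+ q , p , q , p∈x , q∈y , refl
  ; proper    =
      let p , p∉x = proper x
          q , q∉y = proper y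
      in p ℚ.+ q , λ where
           (p′ , q′ , p′∈x , q′∈y , eq) → ℚ.<-irrefl (sym eq)
             (ℚ.+-mono-< (lower<proper x p′∈x p∉x) (lower<proper y q′∈y q∉y))
  ; closed    = down
  ; open′     = λ where
      (p , q , p∈x , q∈y , refl) →
        let p′ , p<p′ , p′∈x = open′ x p∈x
        in p′ ℚ.+ q , ℚ.+-monoˡ-< q p<p′ , p′ , q , p′∈x , q∈y , refl
  }
  where
  down : ∀ {r s} → r ℚ.< s → s ∈ lower x ⊕ lower y → r ∈ lower x ⊕ lower y
  down {r} r<s (p , q , p∈x , q∈y , refl) =
    r ℚ.- q , q ,
    closed x (subst (r ℚ.- q ℚ.<_) ([p+q]-q≡p p q) (ℚ.+-monoˡ-< (ℚ.- q) r<s)) p∈x ,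
    q∈y , sym ([r-q]+q≡r r q)

≤-refl : ∀ {x} → x ≤ x
≤-refl _ = id

≤-trans : ∀ {x y z} → x ≤ y → y ≤ z → x ≤ z
≤-trans x≤y y≤z q = y≤z q ∘ x≤y q

≃-refl : ∀ {x} → x ≃ x
≃-refl {x} = ≤-refl {x} , ≤-refl {x}

≃-isEquivalence : IsEquivalence _≃_
≃-isEquivalence = record
  { refl  = λ {x} → ≃-refl {x}
  ; sym   = λ (x≤y , y≤x) → y≤x , x≤y
  ; trans = λ {x} {y} {z} (x≤y , y≤x) (y≤z , z≤y) →
      ≤-trans {x} {y} {z} x≤y y≤z , ≤-trans {z} {y} {x} z≤y y≤x
  }

≤-isPartialOrder : IsPartialOrder _≃_ _≤_
≤-isPartialOrder = record
  { isPreorder = record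
    { isEquivalence = ≃-isEquivalence
    ; reflexive     = proj₁
    ; trans         = λ {x} {y} {z} → ≤-trans {x} {y} {z}
    }
  ; antisym = _,_
  }

+-mono-≤ : ∀ {x y u v} → x ≤ y → u ≤ v → x + u ≤ y + v
+-mono-≤ x≤y u≤v r (p , q , p∈x , q∈u , eq) = p , q , x≤y p p∈x , u≤v q q∈u , eq

+-comm-≤ : ∀ x y → x + y ≤ y + x
+-comm-≤ x y r (p , q , p∈x , q∈y , eq) =
  q , p , q∈y , p∈x , trans eq (ℚ.+-comm p q)

x≤0+x : ∀ x → x ≤ 0ℝ + x
x≤0+x x r r∈x =
  let q , r<q , q∈x = open′ x r∈x
  in r ℚ.- q , q ,
     subst (r ℚ.- q ℚ.<_) (ℚ.+-inverseʳ q) (ℚ.+-monoˡ-< (ℚ.- q) r<q) ,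
     q∈x , sym ([r-q]+q≡r r q)

x≤x+0 : ∀ x → x ≤ x + 0ℝ
x≤x+0 x = ≤-trans {x} {0ℝ + x} {x + 0ℝ} (x≤0+x x) (+-comm-≤ 0ℝ x)

------------------------------------------------------------------------
-- Categories and the dual Ramsey property

-- Hom-sets are setoids: in the absence of function extensionality,
-- structure maps have to be compared pointwise.
record Category (o h e : Level) : Set (lsuc (o ⊔ h ⊔ e)) where
  infix  4 _≈_
  infixr 9 _·_
  field
    Obj           : Set o
    Hom           : Obj → Obj → Set h
    _≈_           : ∀ {A B} → Rel (Hom A B) e
    ≈-equiv       : ∀ {A B} → IsEquivalence (_≈_ {A} {B})
    idm           : ∀ {A} → Hom A A
    _·_           : ∀ {A B C} → Hom B C → Hom A B → Hom A C
    ·-cong        : ∀ {A B C} {f f′ : Hom B C} {g g′ : Hom A B} →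
                    f ≈ f′ → g ≈ g′ → f · g ≈ f′ · g′
    identityˡ     : ∀ {A B} (f : Hom A B) → idm · f ≈ f
    identityʳ     : ∀ {A B} (f : Hom A B) → f · idm ≈ f
    assoc         : ∀ {A B C D} (f : Hom C D) (g : Hom B C) (h : Hom A B) →
                    (f · g) · h ≈ f · (g · h)

  homSetoid : Obj → Obj → Setoid h e
  homSetoid A B = record { Carrier = Hom A B ; isEquivalence = ≈-equiv }

FullSubcategory : ∀ {o h e ℓ} (𝐂 : Category o h e) →
                  Pred (Category.Obj 𝐂) ℓ → Category (o ⊔ ℓ) h e
FullSubcategory 𝐂 P = record
  { Obj       = Σ[ A ∈ Obj ] P A
  ; Hom       = λ A B → Hom (proj₁ A) (proj₁ B)
  ; _≈_       = _≈_
  ; ≈-equiv   = ≈-equiv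
  ; idm       = idm
  ; _·_       = _·_
  ; ·-cong    = ·-cong
  ; identityˡ = identityˡ
  ; identityʳ = identityʳ
  ; assoc     = assoc
  }
  where open Category 𝐂

module _ {o h e} (𝐂 : Category o h e) where
  open Category 𝐂

  Coloring : ℕ → Obj → Obj → Set (h ⊔ e)
  Coloring k C A = Func (homSetoid C A) (setoid (Fin k))

  DualRamsey : Set (o ⊔ h ⊔ e)
  DualRamsey =
    ∀ (k : ℕ) → 2 ℕ.≤ k → ∀ (A B : Obj) → Hom B A →
    ∃[ C ] ∀ (χ : Coloring k C A) →
    Σ[ w ∈ Hom C B ] ∀ (f g : Hom B A) → Func.to χ (f · w) ≡ Func.to χ (g · w)

------------------------------------------------------------------------
-- Finite linearly ordered metric spaces

record OMet : Set₁ where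
  infix 4 _⊏_
  field
    Carrier            : Set
    size               : ℕ
    finite             : Carrier ↔ Fin size
    d                  : Carrier → Carrier → ℝ
    isMetric           : IsGeneralMetric _≡_ _≃_ _≤_ 0ℝ _+_ d
    _⊏_                : Rel Carrier 0ℓ
    isStrictTotalOrder : IsStrictTotalOrder _≡_ _⊏_

  -- x ⊑ y  means  x ⊏ y ⊎ x ≡ y.
  open StrictToNonStrict _≡_ _⊏_ public using () renaming (_≤_ to _⊑_)

module _ (X Y : OMet) where
  private
    module X = OMet X
    module Y = OMet Y

  IsMinOfFibre : (X.Carrier → Y.Carrier) → Y.Carrier → X.Carrier → Set
  IsMinOfFibre f y m = f m ≡ y × (∀ x → f x ≡ y → m X.⊑ x)

  record IsRigidSurjection (f : X.Carrier → Y.Carrier) : Set where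
    field
      surjective : Surjective _≡_ _≡_ f
      rigid      : ∀ {y y′} → y Y.⊏ y′ → ∀ {m m′} →
                   IsMinOfFibre f y m → IsMinOfFibre f y′ m′ → m X.⊏ m′

  record NERS : Set where
    field
      map               : X.Carrier → Y.Carrier
      nonExpansive      : ∀ x y → Y.d (map x) (map y) ≤ X.d x y
      isRigidSurjection : IsRigidSurjection map

    open IsRigidSurjection isRigidSurjection public

module OrderProperties (X : OMet) where
  open OMet X
  open IsStrictTotalOrder isStrictTotalOrder public
    using (_≟_; compare) renaming (trans to ⊏-trans; irrefl to ⊏-irrefl)

  ⊏-⊑-trans : ∀ {x y z} → x ⊏ y → y ⊑ z → x ⊏ z
  ⊏-⊑-trans x⊏y (inj₁ y⊏z)  = ⊏-trans x⊏y y⊏z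
  ⊏-⊑-trans x⊏y (inj₂ refl) = x⊏y

  ⊑-⊏-trans : ∀ {x y z} → x ⊑ y → y ⊏ z → x ⊏ z
  ⊑-⊏-trans (inj₁ x⊏y)  y⊏z = ⊏-trans x⊏y y⊏z
  ⊑-⊏-trans (inj₂ refl) y⊏z = y⊏z

  ⊑-antisym : ∀ {x y} → x ⊑ y → y ⊑ x → x ≡ y
  ⊑-antisym (inj₂ x≡y) _   = x≡y
  ⊑-antisym (inj₁ x⊏y) y⊑x = contradiction (⊏-⊑-trans x⊏y y⊑x) (⊏-irrefl refl)

  module _ {P : Pred Carrier 0ℓ} (P? : Decidable P) where

    private
      search : ∀ n (g : Fin n → Carrier) →
               (∀ i → ¬ P (g i)) ⊎ ∃[ i ] P (g i) × (∀ j → P (g j) → g i ⊑ g j)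
      search zero    g = inj₁ λ ()
      search (suc n) g with P? (g zero) | search n (g ∘ suc)
      ... | no ¬p | inj₁ none = inj₁ λ where
            zero    → ¬p
            (suc i) → none i
      ... | no ¬p | inj₂ (i , pᵢ , min) = inj₂ (suc i , pᵢ , λ where
            zero    p → contradiction p ¬p
            (suc j) p → min j p)
      ... | yes p | inj₁ none = inj₂ (zero , p , λ where
            zero    _ → inj₂ refl
            (suc j) q → contradiction q (none j))
      ... | yes p | inj₂ (i , pᵢ , min) with compare (g zero) (g (suc i))
      ... | tri< lt _ _ = inj₂ (zero , p , λ where
            zero    _ → inj₂ refl
            (suc j) q → inj₁ (⊏-⊑-trans lt (min j q)))
      ... | tri≈ _ eq _ = inj₂ (zero , p , λ where
            zero    _ → inj₂ refl
            (suc j) q → subst (_⊑ g (suc j)) (sym eq) (min j q))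
      ... | tri> _ _ gt = inj₂ (suc i , pᵢ , λ where
            zero    _ → inj₁ gt
            (suc j) q → min j q)

    minimum : ∀ {x} → P x → ∃[ m ] P m × (∀ y → P y → m ⊑ y)
    minimum {x} px with search size (Inverse.from finite)
    ... | inj₁ none = contradiction
          (subst P (sym (Inverse.strictlyInverseʳ finite x)) px) (none (Inverse.to finite x))
    ... | inj₂ (i , pᵢ , min) = Inverse.from finite i , pᵢ , λ y py →
          subst (Inverse.from finite i ⊑_) (Inverse.strictlyInverseʳ finite y)
            (min (Inverse.to finite y)
              (subst P (sym (Inverse.strictlyInverseʳ finite y)) py))

module _ {X Y : OMet} (f : NERS X Y) where
  private
    module X = OMet X
    module Y = OMet Y
    module f = NERS f

  fibreMinimum : ∀ y → ∃[ m ] IsMinOfFibre X Y f.map y m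
  fibreMinimum y =
    let _ , hit = f.surjective y
    in OrderProperties.minimum X (λ x → OrderProperties._≟_ Y (f.map x) y) (hit refl)

idNERS : ∀ {X} → NERS X X
idNERS {X} = record
  { map               = id
  ; nonExpansive      = λ x y → ≤-refl {d x y}
  ; isRigidSurjection = record
    { surjective = Identity.surjective _≡_
    ; rigid      = λ where y⊏y′ (refl , _) (refl , _) → y⊏y′
    }
  }
  where open OMet X

composeNERS : ∀ {X Y Z} → NERS Y Z → NERS X Y → NERS X Z
composeNERS {X} {Y} {Z} g f = record
  { map               = gf
  ; nonExpansive      = λ x y →
      ≤-trans {Z.d (gf x) (gf y)} {Y.d (f.map x) (f.map y)} {X.d x y}
        (g.nonExpansive (f.map x) (f.map y)) (f.nonExpansive x y)
  ; isRigidSurjection = record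
    { surjective = Composition.surjective _≡_ _≡_ _≡_ f.surjective g.surjective
    ; rigid      = λ z⊏z′ min min′ →
        let minf , ming = image min
            minf′ , ming′ = image min′
        in f.rigid (g.rigid z⊏z′ ming ming′) minf minf′
    }
  }
  where
  module X = OMet X
  module Y = OMet Y
  module Z = OMet Z
  module f = NERS f
  module g = NERS g
  module XP = OrderProperties X
  gf = g.map ∘ f.map

  image : ∀ {z m} → IsMinOfFibre X Z gf z m →
          IsMinOfFibre X Y f.map (f.map m) m × IsMinOfFibre Y Z g.map z (f.map m)
  image {z} {m} (gfm≡z , min)
    with fibreMinimum g z
  ... | p , gp≡z , minp with fibreMinimum f p | fibreMinimum f (f.map m)
  ... | m₁ , fm₁≡p , min₁ | m₂ , fm₂≡fm , min₂ with minp (f.map m) gfm≡z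
  ... | inj₂ refl =
        (refl , λ x fx≡fm → min x (trans (cong g.map fx≡fm) gfm≡z)) ,
        (gp≡z , minp)
  ... | inj₁ p⊏fm = contradiction
        (XP.⊏-⊑-trans
          (XP.⊑-⊏-trans (min m₁ (trans (cong g.map fm₁≡p) gp≡z))
            (f.rigid p⊏fm (fm₁≡p , min₁) (fm₂≡fm , min₂)))
          (min₂ m refl))
        (XP.⊏-irrefl refl)

OMet-ners : Category (lsuc 0ℓ) 0ℓ 0ℓ
OMet-ners = record
  { Obj       = OMet
  ; Hom       = NERS
  ; _≈_       = λ f g → NERS.map f ≗ NERS.map g
  ; ≈-equiv   = record
    { refl  = λ _ → refl
    ; sym   = λ f≗g x → sym (f≗g x)
    ; trans = λ f≗g g≗h x → trans (f≗g x) (g≗h x)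
    }
  ; idm       = idNERS
  ; _·_       = composeNERS
  ; ·-cong    = λ {_} {_} {_} {f} {_} {_} {g′} f≗f′ g≗g′ x →
      trans (cong (NERS.map f) (g≗g′ x)) (f≗f′ (NERS.map g′ x))
  ; identityˡ = λ _ _ → refl
  ; identityʳ = λ _ _ → refl
  ; assoc     = λ _ _ _ _ → refl
  }

------------------------------------------------------------------------
-- Spectra and the spaces 𝓜 n δ

Spec : OMet → Pred ℝ 0ℓ
Spec X δ = ∃[ x ] ∃[ y ] x ≢ y × δ ≃ d x y
  where open OMet X

-- The spectrum of the full subcategory of OMet-ners with objects 𝐂.
SpecOf : ∀ {ℓ} → Pred OMet ℓ → Pred ℝ (lsuc 0ℓ ⊔ ℓ)
SpecOf 𝐂 δ = ∃[ X ] X ∈ 𝐂 × δ ∈ Spec X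

SpecOf⇒positive : ∀ {ℓ} (𝐂 : Pred OMet ℓ) δ → δ ∈ SpecOf 𝐂 → 0ℝ < δ
SpecOf⇒positive _ δ (X , _ , x , y , x≢y , δ≤d , d≤δ) =
  ≤-trans {0ℝ} {d x y} {δ} (nonNegative {x} {y}) d≤δ ,
  λ (_ , δ≤0) → x≢y (0⇒≈
    ( ≤-trans {d x y} {δ} {0ℝ} d≤δ δ≤0
    , nonNegative {x} {y}))
  where
  open OMet X
  open IsGeneralMetric isMetric using (nonNegative; 0⇒≈)

uniformDistance : ∀ n → ℝ → Fin n → Fin n → ℝ
uniformDistance n δ i j with i Fin.≟ j
... | yes _ = 0ℝ
... | no  _ = δ

uniformDistance-isMetric : ∀ n {δ} → 0ℝ < δ →
  IsGeneralMetric _≡_ _≃_ _≤_ 0ℝ _+_ (uniformDistance n δ)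
uniformDistance-isMetric n {δ} (0≤δ , 0≄δ) = record
  { isSemiMetric = record
    { isQuasiSemiMetric = record
      { isPreMetric = record
        { isProtoMetric = record
          { isPartialOrder  = ≤-isPartialOrder
          ; ≈-isEquivalence = isEquivalence
          ; cong            = λ {i} {_} {j} → λ where
              refl refl → ≃-refl {uniformDistance n δ i j}
          ; nonNegative     = λ {i} {j} → nonNeg i j
          }
        ; ≈⇒0 = λ {i} {j} → definite i j
        }
      ; 0⇒≈ = λ {i} {j} → indiscernible i j
      }
    ; sym = symm
    }
  ; triangle = tri
  }
  where
  D = uniformDistance n δ

  nonNeg : ∀ i j → 0ℝ ≤ D i j
  nonNeg i j with i Fin.≟ j
  ... | yes _ = ≤-refl {0ℝ}
  ... | no  _ = 0≤δ

  definite : ∀ i j → i ≡ j → D i j ≃ 0ℝ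
  definite i j i≡j with i Fin.≟ j
  ... | yes _  = ≃-refl {0ℝ}
  ... | no i≢j = contradiction i≡j i≢j

  indiscernible : ∀ i j → D i j ≃ 0ℝ → i ≡ j
  indiscernible i j D≃0 with i Fin.≟ j
  ... | yes i≡j = i≡j
  ... | no  _   = contradiction (proj₂ D≃0 , proj₁ D≃0) 0≄δ

  symm : ∀ i j → D i j ≃ D j i
  symm i j with i Fin.≟ j | j Fin.≟ i
  ... | yes _   | yes _   = ≃-refl {0ℝ}
  ... | no  _   | no  _   = ≃-refl {δ}
  ... | yes i≡j | no j≢i  = contradiction (sym i≡j) j≢i
  ... | no i≢j  | yes j≡i = contradiction (sym j≡i) i≢j

  δ≤δ+ : ∀ {x} → 0ℝ ≤ x → δ ≤ δ + x
  δ≤δ+ {x} 0≤x = ≤-trans {δ} {δ + 0ℝ} {δ + x} (x≤x+0 δ)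
    (+-mono-≤ {δ} {δ} {0ℝ} {x} (≤-refl {δ}) 0≤x)

  tri : ∀ i j k → D i k ≤ D i j + D j k
  tri i j k with i Fin.≟ k
  tri i j k | yes _ = ≤-trans {0ℝ} {0ℝ + 0ℝ} {D i j + D j k} (x≤x+0 0ℝ)
    (+-mono-≤ {0ℝ} {D i j} {0ℝ} {D j k} (nonNeg i j) (nonNeg j k))
  tri i j k | no i≢k with i Fin.≟ j | j Fin.≟ k
  ... | no _    | yes _   = δ≤δ+ {0ℝ} (≤-refl {0ℝ})
  ... | no _    | no _    = δ≤δ+ {δ} 0≤δ
  ... | yes _   | no _    = x≤0+x δ
  ... | yes i≡j | yes j≡k = contradiction (trans i≡j j≡k) i≢k

𝓜 : ∀ n δ → 0ℝ < δ → OMet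
𝓜 n δ δ>0 = record
  { Carrier            = Fin n
  ; size               = n
  ; finite             = ↔-id (Fin n)
  ; d                  = uniformDistance n δ
  ; isMetric           = uniformDistance-isMetric n δ>0
  ; _⊏_                = Fin._<_
  ; isStrictTotalOrder = Fin.<-isStrictTotalOrder
  }

-- Spec X is closed under _≃_, so S is not required to be.
SpecWithin : ∀ {ℓ} → Pred ℝ ℓ → Pred OMet (lsuc 0ℓ ⊔ ℓ)
SpecWithin S X = Spec X ⊆ S

{-# OPTIONS --safe #-}
module Submission where

-- Let δ be the diameter of B; if B has at most one point there is nothing to
-- prove. Every rigid surjection from 𝓜 n δ to B is non-expansive, and so is
-- every rigid surjection to A, which has diameter at most δ. Hence metrics
-- play no role, and for large n the space 𝓜 n δ works by the finite dual
-- Ramsey theorem for chains. The latter is the case of the empty alphabet of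
-- the Graham–Rothschild theorem on k-parameter words, proved by induction
-- on k for all alphabets simultaneously. For k = 0 it is the Hales–Jewett
-- theorem, proved following Shelah. For k + 1 one passes to a host word
-- relative to which the colour of a word depends only on its prefix before
-- the first parameter, then (by Hales–Jewett) only on the length of this
-- prefix, and then (by the pigeonhole principle) on nothing.

open import Defs
open import Level using (0ℓ)
open import Axiom.ExcludedMiddle using (ExcludedMiddle)
open import Data.Nat.Base using (ℕ; _≥_)
open import Data.Product.Base using (_×_; ∃-syntax)
open import Relation.Unary using (Pred; _∈_)

open import Data.Fin.Base as Fin using (Fin; zero; suc; combine; remQuot; funToFin; finToFun)
import Data.Fin.Properties as Fin
open import Data.List.Base using (List; []; _∷_; length)
open import Data.Nat.Base as ℕ using (zero; suc; _^_; z≤n; s≤s; s<s)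
import Data.Nat.Properties as ℕ
open import Data.Product.Base using (Σ-syntax; _,_; proj₁; proj₂)
open import Data.Sum.Base using (_⊎_; inj₁; inj₂)
open import Data.Vec.Base as Vec using (Vec; []; _∷_; allFin; lookup; map; sum; _[_]≔_; replicate)
import Data.Vec.Properties as Vec
open import Data.Vec.Membership.Propositional using () renaming (_∈_ to _∈ᵥ_)
open import Data.Vec.Relation.Unary.All as All using (All; []; _∷_)
import Data.Vec.Relation.Unary.All.Properties as All
open import Data.Vec.Relation.Unary.AllPairs using (AllPairs; []; _∷_)
open import Data.Vec.Relation.Unary.Any using (here; there; index)
import Data.Vec.Relation.Unary.Any.Properties as Any
open import Function.Base using (_∘_; const)
open import Function.Bundles using (Inverse; Func)
open import Function.Metric.Structures using (IsGeneralMetric)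
open import Relation.Binary.Definitions using (DecidableEquality; tri<; tri≈; tri>)
open import Relation.Binary.PropositionalEquality
open import Relation.Binary.Structures using (IsEquivalence)
open import Relation.Nullary.Decidable using (decidable-stable)
open import Relation.Nullary using (yes; no; contradiction)
open import Relation.Unary using (U)

-- Parameter words

-- Word a m n is the set of m-parameter words of length n over an alphabet
-- of a letters: the first occurrence of a parameter is a new, and from
-- then on that parameter is the letter zero, the older letters being
-- shifted by suc. Words in Word 0 m n are the rigid surjections from an
-- n-element chain to an m-element chain.
data Word : ℕ → ℕ → ℕ → Set where
  []     : ∀ {a} → Word a 0 0
  letter : ∀ {a m n} → Fin a → Word a m n → Word a m (suc n)
  new    : ∀ {a m n} → Word (suc a) m n → Word a (suc m) (suc n)

private
  variable
    a b c k m n l r : ℕ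

shift : Vec (Fin (suc a)) a
shift = map suc (allFin _)

lift : Vec (Fin b) a → Vec (Fin (suc b)) (suc a)
lift σ = zero ∷ map suc σ

infixr 9 _⊚_ _∙_

_⊚_ : Vec (Fin c) b → Vec (Fin b) a → Vec (Fin c) a
τ ⊚ σ = map (lookup τ) σ

-- Substitution: each `new` of `w` consumes the next letter of `f`, recorded as its value at the
-- head of `σ`; a `new` of `f` leaves it a parameter.
compose : Vec (Fin b) a → Word a m n → Word b k m → Word b k n
compose σ []           []           = []
compose σ (letter x w) f            = letter (lookup σ x) (compose σ w f)
compose σ (new w)      (letter y f) = letter y (compose (y ∷ σ) w f)
compose σ (new w)      (new f)      = new (compose (lift σ) w f)

_∙_ : Word a m n → Word a k m → Word a k n
_∙_ = compose (allFin _)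

identity : Word a m m
identity {m = zero}  = []
identity {m = suc m} = new identity

-- Renaming is encoded as a composition so that its laws are instances of `compose-assoc`.
rename : Vec (Fin b) a → Word a m n → Word b m n
rename σ w = compose σ w identity

∷-⊚-map-suc : ∀ (y : Fin b) (τ : Vec (Fin b) a) (σ : Vec (Fin a) c) →
              (y ∷ τ) ⊚ map suc σ ≡ τ ⊚ σ
∷-⊚-map-suc y τ σ = sym (Vec.map-∘ (lookup (y ∷ τ)) suc σ)

lift-⊚ : ∀ (τ : Vec (Fin c) b) (σ : Vec (Fin b) a) → lift τ ⊚ lift σ ≡ lift (τ ⊚ σ)
lift-⊚ τ σ = cong (zero ∷_) (begin
  lift τ ⊚ map suc σ           ≡⟨ ∷-⊚-map-suc zero (map suc τ) σ ⟩
  map suc τ ⊚ σ                ≡⟨ Vec.map-cong (λ i → Vec.lookup-map i suc τ) σ ⟩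
  map (suc ∘ lookup τ) σ       ≡⟨ Vec.map-∘ suc (lookup τ) σ ⟩
  map suc (τ ⊚ σ)              ∎)
  where open ≡-Reasoning

⊚-identityˡ : ∀ (σ : Vec (Fin b) a) → allFin b ⊚ σ ≡ σ
⊚-identityˡ σ = trans (Vec.map-cong Vec.lookup-allFin σ) (Vec.map-id σ)

∷-⊚-shift : ∀ (y : Fin b) (τ : Vec (Fin b) a) → (y ∷ τ) ⊚ shift ≡ τ
∷-⊚-shift y τ = trans (∷-⊚-map-suc y τ (allFin _)) (Vec.map-lookup-allFin τ)

compose-assoc : ∀ (τ : Vec (Fin c) b) (σ : Vec (Fin b) a) (w : Word a m n) (f : Word b k m)
                (g : Word c l k) →
                compose τ (compose σ w f) g ≡ compose (τ ⊚ σ) w (compose τ f g)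
compose-assoc τ σ []           []           []           = refl
compose-assoc τ σ (letter x w) f            g            =
  cong₂ letter (sym (Vec.lookup-map x (lookup τ) σ)) (compose-assoc τ σ w f g)
compose-assoc τ σ (new w)      (letter y f) g            =
  cong (letter _) (compose-assoc τ (y ∷ σ) w f g)
compose-assoc τ σ (new w)      (new f)      (letter z g) = cong (letter z)
  (trans (compose-assoc (z ∷ τ) (lift σ) w f g)
         (cong (λ υ → compose (z ∷ υ) w _) (∷-⊚-map-suc z τ σ)))
compose-assoc τ σ (new w)      (new f)      (new g)      = cong new
  (trans (compose-assoc (lift τ) (lift σ) w f g)
         (cong (λ υ → compose υ w (compose (lift τ) f g)) (lift-⊚ τ σ)))

∙-assoc : ∀ (w : Word a m n) (f : Word a k m) (g : Word a l k) → (w ∙ f) ∙ g ≡ w ∙ f ∙ g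
∙-assoc w f g = trans (compose-assoc (allFin _) (allFin _) w f g)
  (cong (λ υ → compose υ w (f ∙ g)) (⊚-identityˡ (allFin _)))

compose-identityˡ : ∀ (σ : Vec (Fin b) a) (f : Word b k m) → compose σ identity f ≡ f
compose-identityˡ σ []           = refl
compose-identityˡ σ (letter y f) = cong (letter y) (compose-identityˡ (y ∷ σ) f)
compose-identityˡ σ (new f)      = cong new (compose-identityˡ (lift σ) f)

compose-rename : ∀ (τ : Vec (Fin c) b) (σ : Vec (Fin b) a) (w : Word a m n) (f : Word c k m) →
                 compose τ (rename σ w) f ≡ compose (τ ⊚ σ) w f
compose-rename τ σ w f = trans (compose-assoc τ σ w identity f)
  (cong (compose (τ ⊚ σ) w) (compose-identityˡ τ f))

compose-∷-shift : ∀ (y : Fin b) (σ : Vec (Fin b) a) (w : Word a m n) (f : Word b k m) →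
                  compose (y ∷ σ) (rename shift w) f ≡ compose σ w f
compose-∷-shift y σ w f = trans (compose-rename (y ∷ σ) shift w f)
  (cong (λ υ → compose υ w f) (∷-⊚-shift y σ))

-- The way inductions lengthen a host `w`: the added parameter occurs only in front and copies the
-- first letter of the word plugged in.
new-∙-letter : ∀ (w : Word a m n) (y : Fin a) (f : Word a k m) →
               new (rename shift w) ∙ letter y f ≡ letter y (w ∙ f)
new-∙-letter w y f = cong (letter y) (compose-∷-shift y (allFin _) w f)

-- The filler zero means the last parameter once there is one, and an alphabet letter if `m` is
-- zero.
pad : m ℕ.≤ n → Word (suc a) m n
pad {n = zero}  z≤n     = []
pad {n = suc n} z≤n     = letter zero (pad z≤n)
pad             (s≤s p) = new (pad p)

-- The Hales–Jewett theorem

-- In Ramsey statements s₀ is a default colour, needed only when there is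
-- nothing to be coloured.
GrahamRothschild : ℕ → ℕ → ℕ → ℕ → Set
GrahamRothschild k a m r =
  ∃[ n ] ∀ (χ : Word a k n → Fin r) (s₀ : Fin r) →
  ∃[ w ] ∃[ s ] ∀ (f : Word a k m) → χ (w ∙ f) ≡ s

-- Numbering the words turns a colouring of all tails into one code, ready for the pigeonhole
-- principle.
encode : Word a 0 n → Fin (a ^ n)
encode []           = zero
encode (letter x u) = combine x (encode u)

decode : ∀ n → Fin (a ^ n) → Word a 0 n
decode zero    _ = []
decode (suc n) i = let x , j = remQuot _ i in letter x (decode n j)

decode-encode : (u : Word a 0 n) → decode n (encode u) ≡ u
decode-encode []                     = refl
decode-encode (letter x u) = trans
  (cong (λ xj → letter (proj₁ xj) (decode _ (proj₂ xj))) (Fin.remQuot-combine x (encode u)))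
  (cong (letter x) (decode-encode u))

-- block p q i prepends the word p … p q … q of length l with i letters p.
block : Fin a → Fin a → Fin (suc l) → Word a m n → Word a m (l ℕ.+ n)
block {l = zero}  p q zero    v = v
block {l = suc l} p q zero    v = letter q (block p q zero v)
block {l = suc l} p q (suc i) v = letter p (block p q i v)

block-constant : ∀ (p q : Fin a) (i : Fin (suc l)) (v : Word a m n) →
                 block q q i v ≡ block p q zero v
block-constant {l = zero}  p q zero    v = refl
block-constant {l = suc l} p q zero    v = cong (letter q) (block-constant p q zero v)
block-constant {l = suc l} p q (suc i) v = cong (letter q) (block-constant p q i v)

compose-block : ∀ (σ : Vec (Fin b) a) (p q : Fin a) (i : Fin (suc l)) (v : Word a m n)
                (f : Word b k m) →
                compose σ (block p q i v) f ≡ block (lookup σ p) (lookup σ q) i (compose σ v f)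
compose-block {l = zero}  σ p q zero    v f = refl
compose-block {l = suc l} σ p q zero    v f = cong (letter _) (compose-block σ p q zero v f)
compose-block {l = suc l} σ p q (suc i) v f = cong (letter _) (compose-block σ p q i v f)

-- The word p … p x … x q … q x₁ … xₙ in which the parameter x occupies
-- the positions where block p q i and block p q j differ.
line : Fin a → Fin a → {i j : Fin (suc l)} → i Fin.< j → Word a (suc n) (l ℕ.+ n)
line {l = suc l} p q {zero}  {suc j} _       = new (block zero (suc q) j identity)
line {l = suc l} p q {suc i} {suc j} (s<s i<j) = letter p (line p q i<j)

compose-block-identity : ∀ (y p q : Fin a) (i : Fin (suc l)) (v : Word a k n) →
  compose (y ∷ allFin a) (block zero (suc q) i identity) v ≡ block y q i v
compose-block-identity y p q i v = begin
  compose (y ∷ allFin _) (block zero (suc q) i identity) v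
    ≡⟨ compose-block _ zero (suc q) i identity v ⟩
  block y (lookup (allFin _) q) i (compose (y ∷ allFin _) identity v)
    ≡⟨ cong₂ (λ z → block y z i) (Vec.lookup-allFin q) (compose-identityˡ _ v) ⟩
  block y q i v ∎
  where open ≡-Reasoning

line-q : ∀ (p q : Fin a) {i j : Fin (suc l)} (i<j : i Fin.< j) (v : Word a k n) →
         line p q i<j ∙ letter q v ≡ block p q i v
line-q {l = suc l} p q {zero}  {suc j} _         v = cong (letter q)
  (trans (compose-block-identity q p q j v) (block-constant p q j v))
line-q {l = suc l} p q {suc i} {suc j} (s<s i<j) v =
  cong₂ letter (Vec.lookup-allFin p) (line-q p q i<j v)

line-p : ∀ (p q : Fin a) {i j : Fin (suc l)} (i<j : i Fin.< j) (v : Word a k n) →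
         line p q i<j ∙ letter p v ≡ block p q j v
line-p {l = suc l} p q {zero}  {suc j} _         v =
  cong (letter p) (compose-block-identity p p q j v)
line-p {l = suc l} p q {suc i} {suc j} (s<s i<j) v =
  cong₂ letter (Vec.lookup-allFin p) (line-p p q i<j v)

collapse : Vec (Fin (suc a)) (suc (suc a))
collapse = zero ∷ allFin _

-- Replaces the letter zero by suc zero.
merge : Word (suc (suc a)) 0 n → Word (suc (suc a)) 0 n
merge u = rename shift (rename collapse u)

-- Some two of the L + 1 blocks assign the same colour to every tail, so on
-- the line joining them the letters zero and suc zero are interchangeable.
insensitivity : ∀ a m r → ∃[ n ] ∀ (χ : Word (suc (suc a)) 0 n → Fin r) →
  ∃[ w ] ∀ (u : Word (suc (suc a)) 0 m) → χ (w ∙ u) ≡ χ (w ∙ merge u)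
insensitivity a zero    r = 0 , λ χ → [] , λ where [] → refl
insensitivity a (suc m) r = L ℕ.+ N , λ χ →
  let code : Fin (suc L) → Fin L
      code i = funToFin (λ t → χ (block p q i (decode N t)))
      i , j , i<j , same = Fin.pigeonhole (ℕ.n<1+n L) code
      ℓ = line p q i<j
      -- Recording the colours for all first letters `y` at once makes the recursive call valid for
      -- every `y`; hence its `r ^ suc (suc a)` colours.
      row = λ t y → χ (ℓ ∙ letter y t)
      w , ins = rest (funToFin ∘ row)

      χ-block : ∀ v → χ (block p q i v) ≡ χ (block p q j v)
      χ-block v = begin
        χ (block p q i v)                     ≡⟨ cong (χ ∘ block p q i) (decode-encode v) ⟨
        χ (block p q i (decode N (encode v))) ≡⟨ Fin.finToFun-funToFin _ (encode v) ⟨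
        finToFun (code i) (encode v)          ≡⟨ cong (λ e → finToFun e (encode v)) same ⟩
        finToFun (code j) (encode v)          ≡⟨ Fin.finToFun-funToFin _ (encode v) ⟩
        χ (block p q j (decode N (encode v))) ≡⟨ cong (χ ∘ block p q j) (decode-encode v) ⟩
        χ (block p q j v)                     ∎

      χ-letter : ∀ y v → χ (ℓ ∙ letter y v) ≡ χ (ℓ ∙ letter (lookup shift (lookup collapse y)) v)
      χ-letter = λ where
        zero v → begin
          χ (ℓ ∙ letter q v)  ≡⟨ cong χ (line-q p q i<j v) ⟩
          χ (block p q i v)   ≡⟨ χ-block v ⟩
          χ (block p q j v)   ≡⟨ cong χ (line-p p q i<j v) ⟨
          χ (ℓ ∙ letter p v)  ∎
        (suc x) v → cong (λ y → χ (ℓ ∙ letter y v)) (sym (begin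
          lookup shift (lookup (allFin _) x) ≡⟨ cong (lookup shift) (Vec.lookup-allFin x) ⟩
          lookup shift x                     ≡⟨ Vec.lookup-map x suc (allFin _) ⟩
          suc (lookup (allFin _) x)          ≡⟨ cong suc (Vec.lookup-allFin x) ⟩
          suc x                              ∎))

      split : ∀ y u → (ℓ ∙ new (rename shift w)) ∙ letter y u ≡ ℓ ∙ letter y (w ∙ u)
      split y u = trans (∙-assoc ℓ (new (rename shift w)) (letter y u))
        (cong (ℓ ∙_) (new-∙-letter w y u))
  in
  ℓ ∙ new (rename shift w) , λ where
    (letter y u) → begin
      χ ((ℓ ∙ new (rename shift w)) ∙ letter y u)
        ≡⟨ cong χ (split y u) ⟩
      χ (ℓ ∙ letter y (w ∙ u))
        ≡⟨ Fin.finToFun-funToFin (row (w ∙ u)) y ⟨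
      finToFun (funToFin (row (w ∙ u))) y
        ≡⟨ cong (λ e → finToFun e y) (ins u) ⟩
      finToFun (funToFin (row (w ∙ merge u))) y
        ≡⟨ Fin.finToFun-funToFin (row (w ∙ merge u)) y ⟩
      χ (ℓ ∙ letter y (w ∙ merge u))
        ≡⟨ χ-letter y (w ∙ merge u) ⟩
      χ (ℓ ∙ letter _ (w ∙ merge u))
        ≡⟨ cong χ (split _ (merge u)) ⟨
      χ ((ℓ ∙ new (rename shift w)) ∙ merge (letter y u)) ∎
  where
  open ≡-Reasoning
  p q : Fin (suc (suc a))
  p = suc zero
  q = zero
  N = proj₁ (insensitivity a m (r ^ suc (suc a)))
  rest = proj₂ (insensitivity a m (r ^ suc (suc a)))
  -- There are `suc (suc a) ^ N` tails, hence `L` colourings of them, one fewer than the blocks.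
  L = r ^ (suc (suc a) ^ N)

unaryWord-unique : (u v : Word 1 0 n) → u ≡ v
unaryWord-unique []              []              = refl
unaryWord-unique (letter zero u) (letter zero v) = cong (letter zero) (unaryWord-unique u v)

-- Induction on the alphabet: on the host given by `insensitivity` a word may be replaced by its
-- merged form, which avoids the letter zero and so is a word over one letter fewer.
halesJewett : ∀ a m r → GrahamRothschild 0 a m r
halesJewett zero          zero    r = 0 , λ χ _ → [] , χ [] , λ where [] → refl
-- No words of positive length exist here, so the default colour is taken.
halesJewett zero          (suc m) r = suc m , λ _ s₀ → identity , s₀ , λ where (letter () _)
halesJewett (suc zero)    m       r = m , λ χ _ →
  identity , χ (pad z≤n) , λ f → cong χ (unaryWord-unique (identity ∙ f) (pad z≤n))
halesJewett (suc (suc a)) m       r =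
  let M , mono = halesJewett (suc a) m r
      N , insens = insensitivity a M r
  in N , λ χ s₀ →
  let w , ins = insens χ
      v , s , χ≡s = mono (λ t → χ (w ∙ rename shift t)) s₀
  in w ∙ rename shift v , s , λ u → begin
    χ ((w ∙ rename shift v) ∙ u)
      ≡⟨ cong χ (∙-assoc w (rename shift v) u) ⟩
    χ (w ∙ rename shift v ∙ u)
      ≡⟨ ins (rename shift v ∙ u) ⟩
    χ (w ∙ merge (rename shift v ∙ u))
      ≡⟨ cong (χ ∘ (w ∙_) ∘ rename shift) (collapse-∙ v u) ⟩
    χ (w ∙ rename shift (v ∙ rename collapse u))
      ≡⟨ χ≡s (rename collapse u) ⟩
    s ∎
  where
  open ≡-Reasoning

  collapse-∙ : (v : Word (suc a) m n) (u : Word (suc (suc a)) 0 m) →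
               rename collapse (rename shift v ∙ u) ≡ v ∙ rename collapse u
  collapse-∙ v u = begin
    rename collapse (rename shift v ∙ u)
      ≡⟨ compose-assoc collapse (allFin _) (rename shift v) u [] ⟩
    compose (collapse ⊚ allFin _) (rename shift v) (rename collapse u)
      ≡⟨ cong (λ υ → compose υ (rename shift v) (rename collapse u))
           (Vec.map-lookup-allFin collapse) ⟩
    compose collapse (rename shift v) (rename collapse u)
      ≡⟨ compose-∷-shift zero (allFin _) v (rename collapse u) ⟩
    v ∙ rename collapse u ∎

-- The Graham–Rothschild theorem

prefix : Word a k n → List (Fin a)
prefix []           = []
prefix (letter x f) = x ∷ prefix f
prefix (new f)      = []

-- The prefix of compose σ w f as a function of the prefix u of f. (A
-- shortage of letters in u is read as a parameter; surplus letters are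
-- ignored.)
composePrefix : Vec (Fin b) a → Word a m n → List (Fin b) → List (Fin b)
composePrefix σ []           u       = []
composePrefix σ (letter x w) u       = lookup σ x ∷ composePrefix σ w u
composePrefix σ (new w)      []      = []
composePrefix σ (new w)      (y ∷ u) = y ∷ composePrefix (y ∷ σ) w u

infixr 9 _∙ₚ_

_∙ₚ_ : Word a m n → List (Fin a) → List (Fin a)
_∙ₚ_ = composePrefix (allFin _)

prefix-compose : ∀ (σ : Vec (Fin b) a) (w : Word a m n) (f : Word b k m) →
                 prefix (compose σ w f) ≡ composePrefix σ w (prefix f)
prefix-compose σ []           []           = refl
prefix-compose σ (letter x w) f            = cong (lookup σ x ∷_) (prefix-compose σ w f)
prefix-compose σ (new w)      (letter y f) = cong (y ∷_) (prefix-compose (y ∷ σ) w f)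
prefix-compose σ (new w)      (new f)      = refl

composePrefix-compose : ∀ (τ : Vec (Fin c) b) (σ : Vec (Fin b) a) (w : Word a m n)
                        (f : Word b k m) (u : List (Fin c)) →
                        composePrefix τ (compose σ w f) u ≡
                        composePrefix (τ ⊚ σ) w (composePrefix τ f u)
composePrefix-compose τ σ []           []           u       = refl
composePrefix-compose τ σ (letter x w) f            u       =
  cong₂ _∷_ (sym (Vec.lookup-map x (lookup τ) σ)) (composePrefix-compose τ σ w f u)
composePrefix-compose τ σ (new w)      (letter y f) u       =
  cong (lookup τ y ∷_) (composePrefix-compose τ (y ∷ σ) w f u)
composePrefix-compose τ σ (new w)      (new f)      []      = refl
composePrefix-compose τ σ (new w)      (new f)      (z ∷ u) = cong (z ∷_)
  (trans (composePrefix-compose (z ∷ τ) (lift σ) w f u)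
         (cong (λ υ → composePrefix (z ∷ υ) w (composePrefix (z ∷ τ) f u))
               (∷-⊚-map-suc z τ σ)))

∙ₚ-assoc : ∀ (w : Word a m n) (f : Word a k m) (u : List (Fin a)) →
           (w ∙ f) ∙ₚ u ≡ w ∙ₚ f ∙ₚ u
∙ₚ-assoc w f u = trans (composePrefix-compose (allFin _) (allFin _) w f u)
  (cong (λ υ → composePrefix υ w (f ∙ₚ u)) (⊚-identityˡ (allFin _)))

composePrefix-identity : ∀ (σ : Vec (Fin b) a) (u : List (Fin b)) → length u ℕ.≤ m →
                         composePrefix σ (identity {m = m}) u ≡ u
composePrefix-identity {m = zero}  σ []      _         = refl
composePrefix-identity {m = suc m} σ []      _         = refl
composePrefix-identity {m = suc m} σ (y ∷ u) (s≤s u≤m) =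
  cong (y ∷_) (composePrefix-identity (y ∷ σ) u u≤m)

composePrefix-∷-shift : ∀ (y : Fin b) (σ : Vec (Fin b) a) (w : Word a m n) (u : List (Fin b)) →
                        length u ℕ.≤ m →
                        composePrefix (y ∷ σ) (rename shift w) u ≡ composePrefix σ w u
composePrefix-∷-shift y σ w u u≤m = begin
  composePrefix (y ∷ σ) (rename shift w) u
    ≡⟨ composePrefix-compose (y ∷ σ) shift w identity u ⟩
  composePrefix ((y ∷ σ) ⊚ shift) w (composePrefix (y ∷ σ) identity u)
    ≡⟨ cong₂ (λ υ → composePrefix υ w) (∷-⊚-shift y σ) (composePrefix-identity (y ∷ σ) u u≤m) ⟩
  composePrefix σ w u ∎
  where open ≡-Reasoning

length-composePrefix : ∀ (σ : Vec (Fin b) a) (w : Word a m n) (u : List (Fin b)) →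
                       length u ≡ m → length (composePrefix σ w u) ≡ n
length-composePrefix σ []           u       _    = refl
length-composePrefix σ (letter x w) u       eq   = cong suc (length-composePrefix σ w u eq)
length-composePrefix σ (new w)      (y ∷ u) refl = cong suc (length-composePrefix (y ∷ σ) w u refl)

length-prefix : (f : Word a (suc k) n) → length (prefix f) ℕ.< n
length-prefix (letter x f) = s<s (length-prefix f)
length-prefix (new f)      = ℕ.z<s

snoc : Word a m n → Word a (suc m) (suc n)
snoc []           = new []
snoc (letter x w) = letter x (snoc w)
snoc (new w)      = new (snoc w)

-- The appended parameter comes after the other `m`, so no letter is left for it and it merely ends
-- the prefix.
composePrefix-snoc : ∀ (σ : Vec (Fin b) a) (w : Word a m n) (u : List (Fin b)) →
                     length u ℕ.≤ m → composePrefix σ (snoc w) u ≡ composePrefix σ w u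
composePrefix-snoc σ []           []      _         = refl
composePrefix-snoc σ (letter x w) u       u≤m       =
  cong (lookup σ x ∷_) (composePrefix-snoc σ w u u≤m)
composePrefix-snoc σ (new w)      []      _         = refl
composePrefix-snoc σ (new w)      (y ∷ u) (s≤s u≤m) =
  cong (y ∷_) (composePrefix-snoc (y ∷ σ) w u u≤m)

fromList : (u : List (Fin a)) → Word a 0 (length u)
fromList []      = []
fromList (x ∷ u) = letter x (fromList u)

prefix-fromList : (u : List (Fin a)) → prefix (fromList u) ≡ u
prefix-fromList []      = refl
prefix-fromList (x ∷ u) = cong (x ∷_) (prefix-fromList u)

-- A list of length `m` fills every parameter of the host, so the resulting prefix is a whole word
-- without parameters.
halesJewett-prefix : ∀ a m r → ∃[ n ] ∀ (χ : List (Fin a) → Fin r) (s₀ : Fin r) →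
  ∃[ w ] ∃[ s ] ∀ u → length u ≡ m → χ (_∙ₚ_ {a} {m} {n} w u) ≡ s
halesJewett-prefix a m r = let N , hj = halesJewett a m r in N , λ χ s₀ →
  let w , s , χ≡s = hj (χ ∘ prefix) s₀ in
  w , s , λ where
    u refl → begin
      χ (w ∙ₚ u)                    ≡⟨ cong (χ ∘ (w ∙ₚ_)) (prefix-fromList u) ⟨
      χ (w ∙ₚ prefix (fromList u))  ≡⟨ cong χ (prefix-compose _ w (fromList u)) ⟨
      χ (prefix (w ∙ fromList u))   ≡⟨ χ≡s (fromList u) ⟩
      s                             ∎
  where open ≡-Reasoning

-- Lengths are treated from the longest down. If `u` has length `m`, it fills `v`, so `v ∙ₚ u` fills
-- `w` and Hales-Jewett fixes the colour; shorter `u` are settled by the choice of `v`.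
prefixLengthColouring : ∀ a m r → ∃[ n ] ∀ (χ : List (Fin a) → Fin r) (s₀ : Fin r) →
  ∃[ w ] Σ[ γ ∈ (ℕ → Fin r) ] ∀ u → length u ℕ.< m → χ (_∙ₚ_ {a} {m} {n} w u) ≡ γ (length u)
prefixLengthColouring a zero    r = 0 , λ χ s₀ → [] , const s₀ , λ _ ()
prefixLengthColouring a (suc m) r =
  let M , rest = prefixLengthColouring a m r
      N , hj   = halesJewett-prefix a M r
  in suc N , λ χ s₀ →
  let w , s , χ≡s = hj χ s₀
      v , γ , χ≡γ = rest (χ ∘ (w ∙ₚ_)) s₀
  in snoc (w ∙ v) , override s γ , λ where
    u (s≤s u≤m) → trans (cong χ (trans (composePrefix-snoc _ (w ∙ v) u u≤m) (∙ₚ-assoc w v u)))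
      (override-elim (χ≡s (v ∙ₚ u) ∘ length-composePrefix _ v u)
                     (χ≡γ u ∘ ℕ.≤∧≢⇒< u≤m))
  where
  override : Fin r → (ℕ → Fin r) → ℕ → Fin r
  override s γ p with p ℕ.≟ m
  ... | yes _ = s
  ... | no  _ = γ p

  override-elim : ∀ {x s γ p} → (p ≡ m → x ≡ s) → (p ≢ m → x ≡ γ p) → x ≡ override s γ p
  override-elim {p = p} eq neq with p ℕ.≟ m
  ... | yes p≡m = eq p≡m
  ... | no  p≢m = neq p≢m

sum-updateAt : ∀ (t : Vec ℕ r) s {d} → lookup t s ≡ suc d → sum t ≡ suc (sum (t [ s ]≔ d))
sum-updateAt (_ ∷ t) zero    refl = refl
sum-updateAt (x ∷ t) (suc s) eq   = trans (cong (x ℕ.+_) (sum-updateAt t s eq)) (ℕ.+-suc x _)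

-- Among n ≥ t₀ + … + tᵣ₋₁ places coloured by γ, some colour s occurs tₛ times.
selectPositions : ∀ n (t : Vec ℕ r) (γ : ℕ → Fin r) → sum t ℕ.≤ n →
  ∃[ s ] ∃[ d ] lookup t s ≡ d ×
  (∃[ w ] ∀ u → length u ℕ.< d → γ (length (_∙ₚ_ {suc a} {d} {n} w u)) ≡ s)
selectPositions n t γ Σt≤n with lookup t (γ 0) in eq
-- The target of this colour is already met, so a host without parameters suffices.
... | zero = γ 0 , 0 , eq , pad z≤n , λ _ ()
selectPositions zero t γ Σt≤0 | suc d =
  contradiction (subst (ℕ._≤ 0) (sum-updateAt t (γ 0) eq) Σt≤0) λ ()
selectPositions {a = a} (suc n) t γ Σt≤1+n | suc d
  with selectPositions {a = a} n (t [ γ 0 ]≔ d) (γ ∘ suc)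
         (ℕ.s≤s⁻¹ (subst (ℕ._≤ suc n) (sum-updateAt t (γ 0) eq) Σt≤1+n))
... | s , e , t′s≡e , w , γ≡s with s Fin.≟ γ 0
-- A place of the wrong colour is filled with the letter zero; one of the right colour becomes a
-- parameter, where the empty prefix ends.
...   | no  s≢ = s , e , trans (sym (Vec.lookup∘update′ s≢ t d)) t′s≡e , letter zero w , γ≡s
...   | yes refl with trans (sym (Vec.lookup∘update (γ 0) t d)) t′s≡e
...     | refl = γ 0 , suc d , eq , new (rename shift w) , λ where
          []      _         → refl
          (y ∷ u) (s<s u<d) → trans
            (cong (γ ∘ suc ∘ length) (composePrefix-∷-shift y _ w u (ℕ.<⇒≤ u<d)))
            (γ≡s u u<d)

-- Pigeonhole with the same target `m` for each of the `r` colours, hence `r` times `m` places.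
monochromaticPositions : ∀ a m r → ∃[ n ] ∀ (γ : ℕ → Fin r) →
  ∃[ w ] ∃[ s ] ∀ u → length u ℕ.< m → γ (length (_∙ₚ_ {suc a} {m} {n} w u)) ≡ s
monochromaticPositions a m r = sum (replicate r m) , λ γ →
  let s , d , t≡d , selected = selectPositions {a = a} _ (replicate r m) γ ℕ.≤-refl
      w , γ≡s = subst (λ d → ∃[ w ] ∀ u → length u ℕ.< d →
                               γ (length (_∙ₚ_ {suc a} {d} w u)) ≡ s)
                      (trans (sym t≡d) (Vec.lookup-replicate s m)) selected
  in w , s , γ≡s

-- Word for word, the colour becomes a function of the prefix: the first
-- letter of the host word is its first parameter, so words starting with a
-- parameter have k parameters left over an alphabet with one more letter,
-- while words starting with a letter y are handled for all y at once by the
-- product colouring.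
prefixColouring : ∀ k a → (∀ m r → GrahamRothschild k (suc a) m r) →
  ∀ m r → ∃[ n ] ∀ (χ : Word a (suc k) n → Fin r) (s₀ : Fin r) →
  ∃[ w ] Σ[ γ ∈ (List (Fin a) → Fin r) ] ∀ (f : Word a (suc k) m) → χ (w ∙ f) ≡ γ (prefix f)
prefixColouring k a gr zero    r = 0 , λ χ s₀ → [] , const s₀ , λ ()
prefixColouring k a gr (suc m) r =
  let M , rest = prefixColouring k a gr m (r ^ a)
      N , mono = gr M r
  in suc N , λ χ s₀ →
  -- This choice settles the words starting with a parameter; `v` below settles those starting with
  -- a letter.
  let w , s , χ≡s = mono (χ ∘ new) s₀
      row = λ f y → χ (letter y (compose (y ∷ allFin a) w f))
      v , γ , χ≡γ = rest (funToFin ∘ row) (funToFin (const {B = Fin a} s₀))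
      v′ = new (rename shift v)
  in new w ∙ v′ , extend s γ , λ where
    (letter y f) → begin
      χ ((new w ∙ v′) ∙ letter y f)       ≡⟨ cong χ (∙-assoc (new w) v′ (letter y f)) ⟩
      χ (new w ∙ v′ ∙ letter y f)         ≡⟨ cong (χ ∘ (new w ∙_)) (new-∙-letter v y f) ⟩
      row (v ∙ f) y                       ≡⟨ Fin.finToFun-funToFin (row (v ∙ f)) y ⟨
      finToFun (funToFin (row (v ∙ f))) y ≡⟨ cong (λ e → finToFun e y) (χ≡γ f) ⟩
      finToFun (γ (prefix f)) y           ∎
    (new f) → begin
      χ ((new w ∙ v′) ∙ new f)                   ≡⟨ cong χ (∙-assoc (new w) v′ (new f)) ⟩
      χ (new (compose (lift (allFin a)) w (compose (lift (allFin a)) (rename shift v) f)))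
        ≡⟨ cong (λ σ → χ (new (compose σ w (compose (lift (allFin a)) (rename shift v) f))))
             (lift-allFin a) ⟩
      χ (new (w ∙ compose (lift (allFin a)) (rename shift v) f))
        ≡⟨ χ≡s _ ⟩
      s ∎
  where
  open ≡-Reasoning

  lift-allFin : ∀ a → lift (allFin a) ≡ allFin (suc a)
  lift-allFin a = sym (Vec.allFin-map a)

  extend : Fin r → (List (Fin a) → Fin (r ^ a)) → List (Fin a) → Fin r
  extend s γ []      = s
  extend s γ (y ∷ u) = finToFun (γ u) y

grahamRothschild : ∀ k a m r → GrahamRothschild k a m r
grahamRothschild zero    a       m r = halesJewett a m r
grahamRothschild (suc k) zero    m r =
  -- Over the empty alphabet every prefix is empty, so a colour depending on the prefix is constant.
  let n , colouring = prefixColouring k 0 (grahamRothschild k 1) m r in n , λ χ s₀ →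
  let w , γ , χ≡γ = colouring χ s₀
  in w , γ [] , λ f → trans (χ≡γ f) (cong γ (noPrefix (prefix f)))
  where
  noPrefix : (u : List (Fin 0)) → u ≡ []
  noPrefix [] = refl
grahamRothschild (suc k) (suc a) m r =
  -- Sizes are chosen from the inside out: `M₁` is the length of `w₃` and the number of parameters
  -- of `w₂`, and `M₂` likewise for `w₂` and `w₁`.
  let M₁ , positions = monochromaticPositions a m r
      M₂ , byLength  = prefixLengthColouring (suc a) M₁ r
      N  , byPrefix  = prefixColouring k (suc a) (grahamRothschild k (suc (suc a))) M₂ r
  in N , λ χ s₀ →
  let w₁ , γ₁ , χ≡γ₁  = byPrefix χ s₀
      w₂ , γ₂ , γ₁≡γ₂ = byLength γ₁ s₀
      w₃ , s  , γ₂≡s  = positions γ₂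
  in w₁ ∙ w₂ ∙ w₃ , s , λ f → begin
    χ ((w₁ ∙ w₂ ∙ w₃) ∙ f)             ≡⟨ cong χ (∙-assoc w₁ (w₂ ∙ w₃) f) ⟩
    χ (w₁ ∙ (w₂ ∙ w₃) ∙ f)             ≡⟨ χ≡γ₁ ((w₂ ∙ w₃) ∙ f) ⟩
    γ₁ (prefix ((w₂ ∙ w₃) ∙ f))        ≡⟨ cong (γ₁ ∘ prefix) (∙-assoc w₂ w₃ f) ⟩
    γ₁ (prefix (w₂ ∙ w₃ ∙ f))          ≡⟨ cong γ₁ (prefix-compose _ w₂ (w₃ ∙ f)) ⟩
    γ₁ (w₂ ∙ₚ prefix (w₃ ∙ f))         ≡⟨ γ₁≡γ₂ _ (length-prefix (w₃ ∙ f)) ⟩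
    γ₂ (length (prefix (w₃ ∙ f)))      ≡⟨ cong (γ₂ ∘ length) (prefix-compose _ w₃ f) ⟩
    γ₂ (length (w₃ ∙ₚ prefix f))       ≡⟨ γ₂≡s (prefix f) (length-prefix f) ⟩
    s                                  ∎
  where open ≡-Reasoning

-- Longer words are reached by repeating the last parameter of a host. As the alphabet is empty,
-- this takes at least one parameter, which `m` being nonzero ensures.
grahamRothschild-≥ : ∀ k m r .{{_ : ℕ.NonZero m}} →
  ∃[ N ] ∀ n → n ≥ N → ∀ (χ : Word 0 k n → Fin r) (s₀ : Fin r) →
  ∃[ w ] ∃[ s ] ∀ (f : Word 0 k m) → χ (w ∙ f) ≡ s
grahamRothschild-≥ k (suc m) r with grahamRothschild k 0 (suc m) r
... | zero  , gr = zero , λ _ _ _ s₀ → contradiction (proj₁ (gr (const s₀) s₀)) λ ()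
... | suc N , gr = suc N , λ where
  (suc n) (s≤s N≤n) χ s₀ →
    let p = new (pad N≤n)
        w , s , χ≡s = gr (χ ∘ (p ∙_)) s₀
    in p ∙ w , s , λ f → trans (cong χ (∙-assoc p w f)) (χ≡s f)

-- Words and rigid surjections

module _ {X : Set} where

  -- If us lists a chain increasingly, then lookup (evaluate [] w us) is the
  -- rigid surjection onto this chain coded by w.
  evaluate : Vec X a → Word a m n → Vec X m → Vec X n
  evaluate ρ []           []       = []
  evaluate ρ (letter x w) us       = lookup ρ x ∷ evaluate ρ w us
  evaluate ρ (new w)      (u ∷ us) = u ∷ evaluate (u ∷ ρ) w us

  -- This identifies `_∙_` with the composition of rigid surjections.
  evaluate-compose : ∀ (ρ : Vec X b) (σ : Vec (Fin b) a) (w : Word a m n) (f : Word b k m)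
                     (us : Vec X k) →
                     evaluate ρ (compose σ w f) us ≡
                     evaluate (map (lookup ρ) σ) w (evaluate ρ f us)
  evaluate-compose ρ σ []           []           []       = refl
  evaluate-compose ρ σ (letter x w) f            us       =
    cong₂ _∷_ (sym (Vec.lookup-map x (lookup ρ) σ)) (evaluate-compose ρ σ w f us)
  evaluate-compose ρ σ (new w)      (letter y f) us       =
    cong (_ ∷_) (evaluate-compose ρ (y ∷ σ) w f us)
  evaluate-compose ρ σ (new w)      (new f)      (u ∷ us) = cong (u ∷_)
    (trans (evaluate-compose (u ∷ ρ) (lift σ) w f us)
           (cong (λ υ → evaluate (u ∷ υ) w (evaluate (u ∷ ρ) f us))
                 (sym (Vec.map-∘ (lookup (u ∷ ρ)) suc σ))))

  Distinct : Vec X n → Set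
  Distinct us = ∀ i j → lookup us i ≡ lookup us j → i ≡ j

  Disjoint : Vec X m → Vec X n → Set
  Disjoint ρ us = ∀ i j → lookup ρ i ≢ lookup us j

  Covers : Vec X n → Vec X m → Set
  Covers xs us = ∀ j → ∃[ i ] lookup xs i ≡ lookup us j

  -- Rigidity phrased without minima of fibres.
  FirstOccurrencesOrdered : Vec X n → Vec X m → Set
  FirstOccurrencesOrdered xs us = ∀ i j j′ → j′ Fin.< j → lookup xs i ≡ lookup us j →
    ∃[ i′ ] i′ Fin.< i × lookup xs i′ ≡ lookup us j′

  private
    variable
      ρ us xs : Vec X n

  distinct-tail : ∀ {u} → Distinct (u ∷ us) → Distinct us
  distinct-tail distinct i j eq = Fin.suc-injective (distinct (suc i) (suc j) eq)

  disjoint-move : ∀ {u} → Distinct (u ∷ us) → Disjoint ρ (u ∷ us) → Disjoint (u ∷ ρ) us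
  disjoint-move distinct disjoint zero    j eq = contradiction (distinct zero (suc j) eq) λ ()
  disjoint-move distinct disjoint (suc i) j eq = disjoint i (suc j) eq

  evaluate-covers : ∀ (ρ : Vec X a) (w : Word a m n) us → Covers (evaluate ρ w us) us
  evaluate-covers ρ (letter x w) us       j       =
    let i , eq = evaluate-covers ρ w us j in suc i , eq
  evaluate-covers ρ (new w)      (u ∷ us) zero    = zero , refl
  evaluate-covers ρ (new w)      (u ∷ us) (suc j) =
    let i , eq = evaluate-covers (u ∷ ρ) w us j in suc i , eq

  evaluate-ordered : ∀ (ρ : Vec X a) (w : Word a m n) us → Distinct us → Disjoint ρ us →
                     FirstOccurrencesOrdered (evaluate ρ w us) us
  evaluate-ordered ρ (letter x w) us distinct disjoint zero j _ _ eq =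
    contradiction eq (disjoint x j)
  evaluate-ordered ρ (letter x w) us distinct disjoint (suc i) j j′ j′<j eq =
    let i′ , i′<i , eq′ = evaluate-ordered ρ w us distinct disjoint i j j′ j′<j eq
    in suc i′ , s<s i′<i , eq′
  evaluate-ordered ρ (new w) (u ∷ us) distinct disjoint zero (suc j) _ _ eq =
    contradiction (distinct zero (suc j) eq) λ ()
  evaluate-ordered ρ (new w) (u ∷ us) distinct disjoint (suc i) (suc j) zero _ eq =
    zero , ℕ.z<s , refl
  evaluate-ordered ρ (new w) (u ∷ us) distinct disjoint (suc i) (suc j) (suc j′) (s<s j′<j) eq =
    let i′ , i′<i , eq′ = evaluate-ordered (u ∷ ρ) w us (distinct-tail distinct)
                            (disjoint-move distinct disjoint) i j j′ j′<j eq
    in suc i′ , s<s i′<i , eq′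

  -- Read `xs` from the left, with the values already seen in `ρ` and those to come in `us`: a value
  -- in `ρ` gives a `letter`, and a fresh one gives `new`.
  recognise : DecidableEquality X →
    ∀ (ρ : Vec X a) (us : Vec X m) (xs : Vec X n) → Distinct us → Disjoint ρ us →
    (∀ i → (∃[ j ] lookup ρ j ≡ lookup xs i) ⊎ (∃[ j ] lookup us j ≡ lookup xs i)) →
    Covers xs us → FirstOccurrencesOrdered xs us →
    ∃[ w ] evaluate ρ w us ≡ xs
  recognise _≟_ ρ []       []       _ _ _ _ _ = [] , refl
  recognise _≟_ ρ (u ∷ us) []       _ _ _ covers _ with covers zero
  ... | () , _
  recognise _≟_ ρ us (x ∷ xs) distinct disjoint occurs covers ordered
    with Fin.any? (λ j → lookup ρ j ≟ x)
  ... | yes (j , ρj≡x) =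
    let w , eq = recognise _≟_ ρ us xs distinct disjoint (occurs ∘ suc) covers′ ordered′
    in letter j w , cong₂ _∷_ ρj≡x eq
    where
    covers′ : Covers xs us
    covers′ k with covers k
    ... | zero  , eq = contradiction (trans ρj≡x eq) (disjoint j k)
    ... | suc i , eq = i , eq

    ordered′ : FirstOccurrencesOrdered xs us
    ordered′ i k k′ k′<k eq with ordered (suc i) k k′ k′<k eq
    ... | zero   , _        , eq′ = contradiction (trans ρj≡x eq′) (disjoint j k′)
    ... | suc i′ , s<s i′<i , eq′ = i′ , i′<i , eq′
  recognise _≟_ ρ us (x ∷ xs) distinct disjoint occurs covers ordered | no x∉ρ
    with occurs zero
  ... | inj₁ x∈ρ = contradiction x∈ρ x∉ρ
  -- A fresh value other than `u` would require an occurrence of `u` before the first place.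
  recognise _≟_ ρ (u ∷ us) (x ∷ xs) distinct disjoint occurs covers ordered | no x∉ρ
      | inj₂ (suc j , eq) =
    contradiction (proj₁ (proj₂ (ordered zero (suc j) zero ℕ.z<s (sym eq)))) λ ()
  recognise _≟_ ρ (u ∷ us) (x ∷ xs) distinct disjoint occurs covers ordered | no x∉ρ
      | inj₂ (zero , refl) =
    let w , eq = recognise _≟_ (u ∷ ρ) us xs (distinct-tail distinct)
                   (disjoint-move distinct disjoint) occurs′ covers′ ordered′
    in new w , cong (u ∷_) eq
    where
    occurs′ : ∀ i → (∃[ j ] lookup (u ∷ ρ) j ≡ lookup xs i) ⊎ (∃[ j ] lookup us j ≡ lookup xs i)
    occurs′ i with occurs (suc i)
    ... | inj₁ (j , eq)     = inj₁ (suc j , eq)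
    ... | inj₂ (zero , eq)  = inj₁ (zero , eq)
    ... | inj₂ (suc j , eq) = inj₂ (j , eq)

    covers′ : Covers xs us
    covers′ j with covers (suc j)
    ... | zero  , eq = contradiction (distinct zero (suc j) eq) λ ()
    ... | suc i , eq = i , eq

    ordered′ : FirstOccurrencesOrdered xs us
    ordered′ i j j′ j′<j eq with ordered (suc i) (suc j) (suc j′) (s<s j′<j) eq
    ... | zero   , _        , eq′ = contradiction (distinct zero (suc j′) eq′) λ ()
    ... | suc i′ , s<s i′<i , eq′ = i′ , i′<i , eq′

evaluate-map : ∀ {X Y : Set} (f : X → Y) (ρ : Vec X a) (w : Word a m n) (us : Vec X m) →
               map f (evaluate ρ w us) ≡ evaluate (map f ρ) w (map f us)
evaluate-map f ρ []           []       = refl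
evaluate-map f ρ (letter x w) us       =
  cong₂ _∷_ (sym (Vec.lookup-map x f ρ)) (evaluate-map f ρ w us)
evaluate-map f ρ (new w)      (u ∷ us) = cong (f u ∷_) (evaluate-map f (u ∷ ρ) w us)

-- Increasing enumerations of finite chains

module _ (X : OMet) where
  open OMet X
  open OrderProperties X

  -- The bijection `finite` may ignore the order, whereas words refer to points in increasing order.
  record Enumeration : Set where
    field
      {length′} : ℕ
      elements  : Vec Carrier length′
      increasing : ∀ {i j} → i Fin.< j → lookup elements i ⊏ lookup elements j
      complete   : ∀ x → ∃[ i ] lookup elements i ≡ x

    distinct : Distinct elements
    distinct i j eq with Fin.<-cmp i j
    ... | tri< i<j _ _ = contradiction (increasing i<j) (⊏-irrefl eq)
    ... | tri≈ _ i≡j _ = i≡j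
    ... | tri> _ _ j<i = contradiction (increasing j<i) (⊏-irrefl (sym eq))

    reflects-< : ∀ {i j} → lookup elements i ⊏ lookup elements j → i Fin.< j
    reflects-< {i} {j} lt with Fin.<-cmp i j
    ... | tri< i<j _ _    = i<j
    ... | tri≈ _ refl _   = contradiction lt (⊏-irrefl refl)
    ... | tri> _ _ j<i    = contradiction (⊏-trans lt (increasing j<i)) (⊏-irrefl refl)

  -- The last component is carried along so that a head smaller than `x` can be put back in front.
  insert : ∀ x (ys : Vec Carrier n) → AllPairs _⊏_ ys →
    ∃[ l ] Σ[ zs ∈ Vec Carrier l ] AllPairs _⊏_ zs × x ∈ᵥ zs ×
    (∀ {y} → y ∈ᵥ ys → y ∈ᵥ zs) × (∀ {y} → y ⊏ x → All (y ⊏_) ys → All (y ⊏_) zs)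
  insert x [] [] = 1 , x ∷ [] , [] ∷ [] , here refl , (λ ()) , λ y⊏x _ → y⊏x ∷ []
  insert x (y ∷ ys) (y⊏ ∷ sorted) with compare x y
  ... | tri< x⊏y _ _ = _ , x ∷ y ∷ ys , (x⊏y ∷ All.map (⊏-trans x⊏y) y⊏) ∷ y⊏ ∷ sorted ,
        here refl , there , _∷_
  ... | tri≈ _ refl _ = _ , y ∷ ys , y⊏ ∷ sorted , here refl , (λ p → p) , λ _ p → p
  ... | tri> _ _ y⊏x =
    let l , zs , sorted′ , x∈zs , ys⊆zs , below = insert x ys sorted in
    _ , y ∷ zs , below y⊏x y⊏ ∷ sorted′ , there x∈zs ,
    (λ where (here eq) → here eq
             (there p) → there (ys⊆zs p)) ,
    λ where z⊏x (z⊏y ∷ z⊏ys) → z⊏y ∷ below z⊏x z⊏ys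

  sort : ∀ n (g : Fin n → Carrier) →
    ∃[ l ] Σ[ zs ∈ Vec Carrier l ] AllPairs _⊏_ zs × (∀ i → g i ∈ᵥ zs)
  sort zero    g = 0 , [] , [] , λ ()
  sort (suc n) g =
    let _ , ys , sorted , g∈ys = sort n (g ∘ suc)
        l , zs , sorted′ , x∈zs , ys⊆zs , _ = insert (g zero) ys sorted
    in l , zs , sorted′ , λ where
      zero    → x∈zs
      (suc i) → ys⊆zs (g∈ys i)

  allPairs-lookup : ∀ {xs : Vec Carrier n} → AllPairs _⊏_ xs → ∀ {i j} → i Fin.< j →
                    lookup xs i ⊏ lookup xs j
  allPairs-lookup (x⊏ ∷ _)      {zero}  {suc j} _         = All.lookup⁺ x⊏ j
  allPairs-lookup (_  ∷ sorted) {suc i} {suc j} (s<s i<j) = allPairs-lookup sorted i<j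

  enumeration : Enumeration
  enumeration =
    let _ , zs , sorted , x∈zs = sort size (Inverse.from finite) in record
    { elements   = zs
    ; increasing = allPairs-lookup sorted
    ; complete   = λ x →
        let p = subst (_∈ᵥ zs) (Inverse.strictlyInverseʳ finite x) (x∈zs (Inverse.to finite x))
        in index p , sym (Any.lookup-index p)
    }

-- Words as non-expansive rigid surjections

module _ {X : OMet} (E : Enumeration X) where
  open OMet X
  open IsGeneralMetric isMetric using (≈⇒0)
  open Enumeration E

  fromWord : ∀ {δ} (δ>0 : 0ℝ < δ) → (∀ x y → d x y ≤ δ) →
             Word 0 length′ n → NERS (𝓜 n δ δ>0) X
  fromWord {n} {δ} δ>0 d≤δ w = record
    { map               = f
    ; nonExpansive      = nonExpansive
    ; isRigidSurjection = record
      { surjective = λ y →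
          let j , eqⱼ = complete y
              i , eqᵢ = evaluate-covers [] w elements j
          in i , λ where refl → trans eqᵢ eqⱼ
      ; rigid = rigid
      }
    }
    where
    f = lookup (evaluate [] w elements)

    nonExpansive : ∀ i j → d (f i) (f j) ≤ uniformDistance n δ i j
    nonExpansive i j with i Fin.≟ j
    ... | yes refl = proj₁ (≈⇒0 refl)
    ... | no  _    = d≤δ (f i) (f j)

    rigid : ∀ {y y′} → y ⊏ y′ → ∀ {i i′} → IsMinOfFibre (𝓜 n δ δ>0) X f y i →
            IsMinOfFibre (𝓜 n δ δ>0) X f y′ i′ → i Fin.< i′
    rigid {y} {y′} y⊏y′ {i} {i′} (_ , minimal) (fi′≡y′ , _) with complete y | complete y′
    ... | j , refl | j′ , refl =
      -- Some `h` before `i′` lies over `y`, and the minimum `i` of that fibre is at most `h`.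
      let h , h<i′ , fh≡y = evaluate-ordered [] w elements distinct (λ ()) i′ j′ j
                              (reflects-< y⊏y′) fi′≡y′
      in OrderProperties.⊑-⊏-trans (𝓜 n δ δ>0) (minimal h fh≡y) h<i′

module _ {X Y : OMet} (E : Enumeration X) (F : Enumeration Y) where
  private
    module X = OMet X
    module Y = OMet Y
    module E = Enumeration E
    module F = Enumeration F

  toWord : (f : NERS X Y) →
           ∃[ w ] evaluate [] w F.elements ≡ map (NERS.map f) E.elements
  toWord f = recognise (OrderProperties._≟_ Y) [] F.elements fE F.distinct (λ ())
    (λ i → inj₂ (F.complete (lookup fE i))) covers ordered
    where
    module f = NERS f
    fE = map f.map E.elements

    lookup-fE : ∀ i → lookup fE i ≡ f.map (lookup E.elements i)
    lookup-fE i = Vec.lookup-map i f.map E.elements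

    covers : Covers fE F.elements
    covers j =
      let x , hit = f.surjective (lookup F.elements j)
          i , eq  = E.complete x
      in i , trans (lookup-fE i) (hit eq)

    ordered : FirstOccurrencesOrdered fE F.elements
    ordered i j j′ j′<j eq
      -- The witness is the minimum over `j′`: by rigidity it precedes the minimum over `j`, which
      -- is at most the point at `i`.
      with fibreMinimum f (lookup F.elements j) | fibreMinimum f (lookup F.elements j′)
    ... | x , x-min | x′ , x′-min with E.complete x′
    ... | i′ , refl = i′ , E.reflects-< x′⊏xᵢ , trans (lookup-fE i′) (proj₁ x′-min)
      where
      x′⊏xᵢ : lookup E.elements i′ X.⊏ lookup E.elements i
      x′⊏xᵢ = OrderProperties.⊏-⊑-trans X (f.rigid (F.increasing j′<j) x′-min x-min)
                (proj₂ x-min _ (trans (sym (lookup-fE i)) eq))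

  -- Carries a colouring of morphisms over to words: `f` acts on the listed values by naturality,
  -- its own list is the evaluation of its word, and the two evaluations fuse.
  fromWord-∙ : ∀ {n δ} (δ>0 : 0ℝ < δ) (X≤δ : ∀ x y → X.d x y ≤ δ) (Y≤δ : ∀ x y → Y.d x y ≤ δ)
               (f : NERS X Y) (w : Word 0 E.length′ n) →
               NERS.map (composeNERS f (fromWord E {δ = δ} δ>0 X≤δ w)) ≗
               NERS.map (fromWord F {δ = δ} δ>0 Y≤δ (w ∙ proj₁ (toWord f)))
  fromWord-∙ δ>0 X≤δ Y≤δ f w i = let v , eq = toWord f in begin
    f.map (lookup (evaluate [] w E.elements) i)
      ≡⟨ Vec.lookup-map i f.map (evaluate [] w E.elements) ⟨
    lookup (map f.map (evaluate [] w E.elements)) i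
      ≡⟨ cong (λ us → lookup us i) (evaluate-map f.map [] w E.elements) ⟩
    lookup (evaluate [] w (map f.map E.elements)) i
      ≡⟨ cong (λ us → lookup (evaluate [] w us) i) eq ⟨
    lookup (evaluate [] w (evaluate [] v F.elements)) i
      ≡⟨ cong (λ us → lookup us i) (evaluate-compose [] [] w v F.elements) ⟨
    lookup (evaluate [] (w ∙ v) F.elements) i ∎
    where
    open ≡-Reasoning
    module f = NERS f

-- The dual Ramsey property

module _ (em : ExcludedMiddle 0ℓ) where

  -- If some `q` in the cut `y` is not in `x`, then `q` exceeds all of `x`, and `x ≤ y` follows.
  ≤-total : ∀ x y → x ≤ y ⊎ y ≤ x
  ≤-total x y with em {x ≤ y}
  ... | yes x≤y = inj₁ x≤y
  ... | no  x≰y = inj₂ λ q q∈y → decidable-stable em λ q∉x →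
        x≰y λ p p∈x → ℝ.closed y (lower<proper x p∈x q∉x) q∈y

  maximumOn : ∀ n (h : Fin (suc n) → ℝ) → ∃[ i ] ∀ j → h j ≤ h i
  maximumOn zero    h = zero , λ where zero → ≤-refl {h zero}
  maximumOn (suc n) h with maximumOn n (h ∘ suc)
  ... | i , max with ≤-total (h zero) (h (suc i))
  ...   | inj₁ h₀≤hᵢ = suc i , λ where
            zero    → h₀≤hᵢ
            (suc j) → max j
  ...   | inj₂ hᵢ≤h₀ = zero , λ where
            zero    → ≤-refl {h zero}
            (suc j) → ≤-trans {h (suc j)} {h (suc i)} {h zero} (max j) hᵢ≤h₀

  module _ (X : OMet) where
    open OMet X
    open IsGeneralMetric isMetric using (nonNegative; ≈⇒0; 0⇒≈)

    maximum : Carrier → (h : Carrier → ℝ) → ∃[ x ] ∀ y → h y ≤ h x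
    maximum x h = go size (Inverse.to finite x) (Inverse.from finite)
      (λ y → Inverse.to finite y , Inverse.strictlyInverseʳ finite y)
      where
      go : ∀ n → Fin n → (g : Fin n → Carrier) → (∀ y → ∃[ i ] g i ≡ y) →
           ∃[ x ] ∀ y → h y ≤ h x
      go (suc n) _ g surj =
        let i , max = maximumOn n (h ∘ g)
        in g i , λ y → let j , gj≡y = surj y in subst (λ z → h z ≤ h (g i)) gj≡y (max j)

    diameter : ∀ {x y} → x ≢ y → ∃[ δ ] δ ∈ Spec X × (∀ u v → d u v ≤ δ)
    diameter {x} {y} x≢y =
      -- `far u` is a point farthest from `u`; maximising once more over `u` gives the diameter.
      let far = λ u → proj₁ (maximum x (d u))
          u , max = maximum x (λ u → d u (far u))
          δ = d u (far u)
          d≤δ : ∀ v w → d v w ≤ δ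
          d≤δ v w = ≤-trans {d v w} {d v (far v)} {δ} (proj₂ (maximum x (d v)) w) (max v)
      -- If `u` were `far u`, then `δ` and with it the distance of `x` and `y` would vanish.
      in δ , (u , far u , (λ eq → x≢y (0⇒≈
           ( ≤-trans {d x y} {δ} {0ℝ} (d≤δ x y) (proj₁ (≈⇒0 eq)) , nonNegative {x} {y})))
           , ≃-refl {δ}) , d≤δ

  dualRamsey : ∀ {ℓ} (𝐂 : Pred OMet ℓ) →
    (∀ (m : ℕ) → m ≥ 1 → ∀ (δ : ℝ) → (δ∈Spec : δ ∈ SpecOf 𝐂) →
      ∃[ n ] n ≥ m × 𝓜 n δ (SpecOf⇒positive 𝐂 δ δ∈Spec) ∈ 𝐂) →
    DualRamsey (FullSubcategory OMet-ners 𝐂)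
  dualRamsey 𝐂 uniform (suc k) _ (A , A∈𝐂) (B , B∈𝐂) h
    with em {∃[ x ] ∃[ y ] x ≢ y}
  -- With at most one point in `B` all morphisms to `A` agree, so `B` is its own Ramsey object.
  ... | no trivial = (B , B∈𝐂) , λ χ → idNERS , λ f g → Func.cong χ (constant f g)
    where
    module B = OMet B

    B-unique : ∀ (x y : B.Carrier) → x ≡ y
    B-unique x y = decidable-stable em λ x≢y → trivial (x , y , x≢y)

    constant : (f g : NERS B A) → NERS.map f ≗ NERS.map g
    constant f g x =
      let y , hit = NERS.surjective f (NERS.map g x)
      in trans (cong (NERS.map f) (B-unique x y)) (hit refl)
  ... | yes (x , y , x≢y) =
    let δ , δ∈SpecB , B≤δ = diameter B x≢y
        δ∈Spec = B , B∈𝐂 , δ∈SpecB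
        δ>0 = SpecOf⇒positive 𝐂 δ δ∈Spec

        A≤δ : ∀ u v → OMet.d A u v ≤ δ
        A≤δ u v =
          let u′ , hu′≡u = NERS.surjective h u
              v′ , hv′≡v = NERS.surjective h v
          in subst₂ (λ u v → OMet.d A u v ≤ δ) (hu′≡u refl) (hv′≡v refl)
               (≤-trans {OMet.d A (NERS.map h u′) (NERS.map h v′)} {OMet.d B u′ v′} {δ}
                 (NERS.nonExpansive h u′ v′) (B≤δ u′ v′))

        E = enumeration A
        F = enumeration B
        N , gr = grahamRothschild-≥ (Enumeration.length′ E) (Enumeration.length′ F) (suc k)
                   {{Fin.nonZeroIndex (proj₁ (Enumeration.complete F x))}}
        -- `suc N` rather than `N`, since the hypothesis asks for a positive bound.
        n , n>N , 𝓜∈𝐂 = uniform (suc N) (s≤s z≤n) δ δ∈Spec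
    in (𝓜 n δ δ>0 , 𝓜∈𝐂) , λ χ →
    -- `χ` is pulled back to words coding surjections onto `A`; `zero` is the default colour.
    let w , s , χ≡s = gr n (ℕ.<⇒≤ n>N) (λ v → Func.to χ (fromWord E {δ = δ} δ>0 A≤δ v)) zero

        monochromatic : ∀ (f : NERS B A) →
          Func.to χ (composeNERS f (fromWord F {δ = δ} δ>0 B≤δ w)) ≡ s
        monochromatic f = trans (Func.cong χ (fromWord-∙ F E {δ = δ} δ>0 B≤δ A≤δ f w))
                                (χ≡s (proj₁ (toWord F E f)))
    in fromWord F {δ = δ} δ>0 B≤δ w , λ f g → trans (monochromatic f) (sym (monochromatic g))

theorem3p4 : ∀ {ℓ} → ExcludedMiddle 0ℓ →
    ((𝐂 : Pred OMet ℓ) →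
    (∀ (m : ℕ) → m ≥ 1 → ∀ (δ : ℝ) → (δ∈Spec : δ ∈ SpecOf 𝐂) →
    ∃[ n ] n ≥ m × 𝓜 n δ (SpecOf⇒positive 𝐂 δ δ∈Spec) ∈ 𝐂) →
    DualRamsey (FullSubcategory OMet-ners 𝐂))
    × DualRamsey OMet-ners
    × ((S : Pred ℝ ℓ) → DualRamsey (FullSubcategory OMet-ners (SpecWithin S)))
theorem3p4 em = dualRamsey em , all , within
  where
  all : DualRamsey OMet-ners
  all k k≥2 A B f =
    let (C , _) , ramsey = dualRamsey em U (λ m _ _ _ → m , ℕ.≤-refl , _) k k≥2 (A , _) (B , _) f
    in C , ramsey

  -- The only nonzero distance is `δ`, which by assumption equals a distance in a space whose
  -- spectrum lies in `S`.
  uniform-within : ∀ {ℓ} (S : Pred ℝ ℓ) n δ (δ∈Spec : δ ∈ SpecOf (SpecWithin S)) →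
                   𝓜 n δ (SpecOf⇒positive (SpecWithin S) δ δ∈Spec) ∈ SpecWithin S
  uniform-within S n δ (X , X∈ , x , y , x≢y , δ≃d) {ε} (i , j , i≢j , ε≃) with i Fin.≟ j
  ... | yes i≡j = contradiction i≡j i≢j
  ... | no  _   = X∈ (x , y , x≢y ,
        IsEquivalence.trans ≃-isEquivalence {ε} {δ} {OMet.d X x y} ε≃ δ≃d)

  within : ∀ S → DualRamsey (FullSubcategory OMet-ners (SpecWithin S))
  within S = dualRamsey em (SpecWithin S) λ m _ δ δ∈Spec →
    m , ℕ.≤-refl , λ {ε} → uniform-within S m δ δ∈Spec {ε}
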